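{- Let $n\geq 1$, $q\geq 2$ and $s\geq 0$ be integers. For each $1\leq i\leq n$ let $A_i\subseteq \mathbb{R}$ be a subset with $|A_i|=q$, and consider the box $\mathcal{B}:=\prod_{i=1}^n A_i\subseteq \mathbb{R}^n$. Suppose that $\mathcal{F}\subseteq \mathcal{B}$ is a set satisfying the following properties: (i) $(\mathbf{f},\mathbf{f})\notin s(\mathcal{F})$ for each $\mathbf{f}\in \mathcal{F}$; (ii) $|s(\mathcal{F})|\leq s$. Then $$ |\mathcal{F}|\leq \Big|\Big\{x_1^{\alpha_1}\cdots x_n^{\alpha_n}:~ 0\leq \alpha_i \leq q-1 \text{ for each } 1\le i\le n,\ \sum_{i=1}^n \alpha_i \leq s \Big\}\Big|, $$ where the set on the right is a set of monomials in the variables $x_1,\dots,x_n$ with integer exponents $\alpha_i$.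
   Context: $(\mathbf{x},\mathbf{y})$ denotes the standard scalar product on $\mathbb{R}^n$. For a set $\mathcal{G}\subseteq\mathbb{R}^n$, $s(\mathcal{G})$ denotes the set of scalar products between distinct points of $\mathcal{G}$: $s(\mathcal{G}):=\{(\mathbf{p}_1,\mathbf{p}_2): \mathbf{p}_1,\mathbf{p}_2\in\mathcal{G},\ \mathbf{p}_1\neq\mathbf{p}_2\}$. (The integer $s$ in the claim is a number, distinct from the set-valued notation $s(\cdot)$.) -}

module Defs where

open import Data.Fin.Base using (Fin)
open import Data.Nat.Base as ℕ using (ℕ)
import Data.Nat.Properties as ℕ
open import Data.Product.Base using (∃-syntax; _×_; _,_; proj₁)
open import Data.Rational.Base as ℚ using (ℚ; 0ℚ; 1ℚ; ½; ∣_∣)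
import Data.Rational.Properties as ℚ
open import Data.Rational.Solver using (module +-*-Solver)
open import Data.Vec.Functional using (Vector; foldr; zipWith)
open import Data.Vec.Functional.Relation.Binary.Equality.Setoid using (≋-setoid)
open import Function.Bundles using (Bijection; Injection)
open import Level using (Level; 0ℓ; _⊔_) renaming (suc to lsuc)
open import Relation.Binary.Bundles using (Setoid)
open import Relation.Binary.Definitions using (_Respects_)
import Relation.Binary.Construct.On as On
open import Relation.Binary.PropositionalEquality
  using (_≡_; refl; sym; trans; cong; cong₂; subst) renaming (setoid to ≡-setoid)
open import Relation.Nullary.Negation using (¬_)
open import Relation.Unary using (Pred)

private
  variable
    a c ℓ p : Level

module Estimates where
  0<½* : ∀ {ε} → 0ℚ ℚ.< ε → 0ℚ ℚ.< ½ ℚ.* ε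
  0<½* {ε} 0<ε = ℚ.positive⁻¹ (½ ℚ.* ε) {{ℚ.pos*pos⇒pos ½ ε {{ℚ.positive 0<ε}}}}

  ½*+½* : ∀ ε → ½ ℚ.* ε ℚ.+ ½ ℚ.* ε ≡ ε
  ½*+½* ε = trans (sym (ℚ.*-distribʳ-+ ε ½ ½)) (ℚ.*-identityˡ ε)

  module Identities where
    open +-*-Solver

    neg-minus : ∀ u v → u ℚ.- v ≡ ℚ.- (v ℚ.- u)
    neg-minus = solve 2 (λ u v → u :- v := :- (v :- u)) refl

    minus-plus : ∀ u v → (u ℚ.- v) ℚ.+ v ≡ u
    minus-plus = solve 2 (λ u v → (u :- v) :+ v := u) refl

    telescope : ∀ u v w → (u ℚ.- v) ℚ.+ (v ℚ.- w) ≡ u ℚ.- w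
    telescope = solve 3 (λ u v w → (u :- v) :+ (v :- w) := u :- w) refl

    sum-minus-sum : ∀ u v u′ v′ →
      (u ℚ.- u′) ℚ.+ (v ℚ.- v′) ≡ (u ℚ.+ v) ℚ.- (u′ ℚ.+ v′)
    sum-minus-sum = solve 4 (λ u v u′ v′ →
      (u :- u′) :+ (v :- v′) := (u :+ v) :- (u′ :+ v′)) refl

    product-minus-product : ∀ u v u′ v′ →
      u ℚ.* (v ℚ.- v′) ℚ.+ v′ ℚ.* (u ℚ.- u′) ≡ u ℚ.* v ℚ.- u′ ℚ.* v′
    product-minus-product = solve 4 (λ u v u′ v′ →
      u :* (v :- v′) :+ v′ :* (u :- u′) := u :* v :- u′ :* v′) refl

  open Identities public

  ∣-∣-sym : ∀ u v → ∣ u ℚ.- v ∣ ≡ ∣ v ℚ.- u ∣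
  ∣-∣-sym u v = trans (cong ∣_∣ (neg-minus u v)) (ℚ.∣-p∣≡∣p∣ (v ℚ.- u))

  ∣-∣-trans : ∀ u v w → ∣ u ℚ.- w ∣ ℚ.≤ ∣ u ℚ.- v ∣ ℚ.+ ∣ v ℚ.- w ∣
  ∣-∣-trans u v w = subst (λ t → ∣ t ∣ ℚ.≤ ∣ u ℚ.- v ∣ ℚ.+ ∣ v ℚ.- w ∣)
    (telescope u v w) (ℚ.∣p+q∣≤∣p∣+∣q∣ (u ℚ.- v) (v ℚ.- w))

  ∣-∣-+ : ∀ u v u′ v′ →
          ∣ (u ℚ.+ v) ℚ.- (u′ ℚ.+ v′) ∣ ℚ.≤ ∣ u ℚ.- u′ ∣ ℚ.+ ∣ v ℚ.- v′ ∣
  ∣-∣-+ u v u′ v′ = subst (λ t → ∣ t ∣ ℚ.≤ ∣ u ℚ.- u′ ∣ ℚ.+ ∣ v ℚ.- v′ ∣)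
    (sum-minus-sum u v u′ v′) (ℚ.∣p+q∣≤∣p∣+∣q∣ (u ℚ.- u′) (v ℚ.- v′))

  ∣-∣-* : ∀ u v u′ v′ →
          ∣ u ℚ.* v ℚ.- u′ ℚ.* v′ ∣ ℚ.≤ ∣ u ∣ ℚ.* ∣ v ℚ.- v′ ∣ ℚ.+ ∣ v′ ∣ ℚ.* ∣ u ℚ.- u′ ∣
  ∣-∣-* u v u′ v′ = begin
    ∣ u ℚ.* v ℚ.- u′ ℚ.* v′ ∣
      ≡⟨ cong ∣_∣ (product-minus-product u v u′ v′) ⟨
    ∣ u ℚ.* (v ℚ.- v′) ℚ.+ v′ ℚ.* (u ℚ.- u′) ∣
      ≤⟨ ℚ.∣p+q∣≤∣p∣+∣q∣ (u ℚ.* (v ℚ.- v′)) (v′ ℚ.* (u ℚ.- u′)) ⟩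
    ∣ u ℚ.* (v ℚ.- v′) ∣ ℚ.+ ∣ v′ ℚ.* (u ℚ.- u′) ∣
      ≡⟨ cong₂ ℚ._+_ (ℚ.∣p*q∣≡∣p∣*∣q∣ u (v ℚ.- v′)) (ℚ.∣p*q∣≡∣p∣*∣q∣ v′ (u ℚ.- u′)) ⟩
    ∣ u ∣ ℚ.* ∣ v ℚ.- v′ ∣ ℚ.+ ∣ v′ ∣ ℚ.* ∣ u ℚ.- u′ ∣ ∎
    where open ℚ.≤-Reasoning

  ∣∣*∣∣-mono-< : ∀ u v B δ → 0ℚ ℚ.< δ → ∣ u ∣ ℚ.< B → ∣ v ∣ ℚ.< δ →
                 ∣ u ∣ ℚ.* ∣ v ∣ ℚ.< B ℚ.* δ
  ∣∣*∣∣-mono-< u v B δ 0<δ u<B v<δ = ℚ.≤-<-trans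
    (ℚ.*-monoˡ-≤-nonNeg ∣ u ∣ {{ℚ.∣-∣-nonNeg u}} (ℚ.<⇒≤ v<δ))
    (ℚ.*-monoˡ-<-pos δ {{ℚ.positive 0<δ}} u<B)

  ∣-∣-*-< : ∀ u v u′ v′ B δ ε → 0ℚ ℚ.< δ → B ℚ.* δ ≡ ½ ℚ.* ε →
            ∣ u ∣ ℚ.< B → ∣ v′ ∣ ℚ.< B → ∣ u ℚ.- u′ ∣ ℚ.< δ → ∣ v ℚ.- v′ ∣ ℚ.< δ →
            ∣ u ℚ.* v ℚ.- u′ ℚ.* v′ ∣ ℚ.< ε
  ∣-∣-*-< u v u′ v′ B δ ε 0<δ B*δ u<B v′<B u-u′<δ v-v′<δ = begin-strict
    ∣ u ℚ.* v ℚ.- u′ ℚ.* v′ ∣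
      ≤⟨ ∣-∣-* u v u′ v′ ⟩
    ∣ u ∣ ℚ.* ∣ v ℚ.- v′ ∣ ℚ.+ ∣ v′ ∣ ℚ.* ∣ u ℚ.- u′ ∣
      <⟨ ℚ.+-mono-< (∣∣*∣∣-mono-< u (v ℚ.- v′) B δ 0<δ u<B v-v′<δ)
                    (∣∣*∣∣-mono-< v′ (u ℚ.- u′) B δ 0<δ v′<B u-u′<δ) ⟩
    B ℚ.* δ ℚ.+ B ℚ.* δ
      ≡⟨ trans (cong₂ ℚ._+_ B*δ B*δ) (½*+½* ε) ⟩
    ε ∎
    where open ℚ.≤-Reasoning

  divide : ∀ B η → 0ℚ ℚ.< B → 0ℚ ℚ.< η → ∃[ δ ] (0ℚ ℚ.< δ × B ℚ.* δ ≡ η)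
  divide B η 0<B 0<η = B⁻¹ ℚ.* η ,
    ℚ.positive⁻¹ (B⁻¹ ℚ.* η)
      {{ℚ.pos*pos⇒pos B⁻¹ {{ℚ.1/pos⇒pos B {{ℚ.positive 0<B}}}} η {{ℚ.positive 0<η}}}} ,
    trans (sym (ℚ.*-assoc B B⁻¹ η))
      (trans (cong (ℚ._* η) (ℚ.*-inverseʳ B {{ℚ.pos⇒nonZero B {{ℚ.positive 0<B}}}}))
             (ℚ.*-identityˡ η))
    where
    B⁻¹ : ℚ
    B⁻¹ = (ℚ.1/ B) {{ℚ.pos⇒nonZero B {{ℚ.positive 0<B}}}}

open Estimates public

-- The reals are Cauchy sequences of rationals, with equality the setoid
-- relation _≈ℝ_: the termwise difference tends to zero.

IsCauchy : (ℕ → ℚ) → Set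
IsCauchy x = ∀ ε → 0ℚ ℚ.< ε →
  ∃[ N ] (∀ m k → N ℕ.≤ m → N ℕ.≤ k → ∣ x m ℚ.- x k ∣ ℚ.< ε)

record ℝ : Set where
  constructor mkℝ
  field
    seq      : ℕ → ℚ
    isCauchy : IsCauchy seq

open ℝ public

infix 4 _≈ℝ_

record _≈ℝ_ (x y : ℝ) : Set where
  constructor mk≈
  field
    close : ∀ ε → 0ℚ ℚ.< ε → ∃[ N ] (∀ k → N ℕ.≤ k → ∣ seq x k ℚ.- seq y k ∣ ℚ.< ε)

open _≈ℝ_ public

≈ℝ-refl : ∀ {x} → x ≈ℝ x
close (≈ℝ-refl {x}) ε 0<ε =
  0 , λ k _ → subst (ℚ._< ε) (sym (cong ∣_∣ (ℚ.+-inverseʳ (seq x k)))) 0<ε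

≈ℝ-sym : ∀ {x y} → x ≈ℝ y → y ≈ℝ x
close (≈ℝ-sym {x} {y} x≈y) ε 0<ε with close x≈y ε 0<ε
... | N , h = N , λ k N≤k → subst (ℚ._< ε) (∣-∣-sym (seq x k) (seq y k)) (h k N≤k)

≈ℝ-trans : ∀ {x y z} → x ≈ℝ y → y ≈ℝ z → x ≈ℝ z
close (≈ℝ-trans {x} {y} {z} x≈y y≈z) ε 0<ε
  with close x≈y (½ ℚ.* ε) (0<½* 0<ε) | close y≈z (½ ℚ.* ε) (0<½* 0<ε)
... | N₁ , h₁ | N₂ , h₂ = N₁ ℕ.⊔ N₂ , λ k N≤k →
  ℚ.≤-<-trans (∣-∣-trans (seq x k) (seq y k) (seq z k))
    (subst (_ ℚ.<_) (½*+½* ε)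
      (ℚ.+-mono-< (h₁ k (ℕ.m⊔n≤o⇒m≤o N₁ N₂ N≤k)) (h₂ k (ℕ.m⊔n≤o⇒n≤o N₁ N₂ N≤k))))

ℝ-setoid : Setoid 0ℓ 0ℓ
ℝ-setoid = record
  { Carrier       = ℝ
  ; _≈_           = _≈ℝ_
  ; isEquivalence = record { refl = ≈ℝ-refl ; sym = ≈ℝ-sym ; trans = ≈ℝ-trans }
  }

fromℚ : ℚ → ℝ
seq      (fromℚ r) _       = r
isCauchy (fromℚ r) ε 0<ε =
  0 , λ _ _ _ _ → subst (ℚ._< ε) (sym (cong ∣_∣ (ℚ.+-inverseʳ r))) 0<ε

0ℝ : ℝ
0ℝ = fromℚ 0ℚ

infixl 6 _+ℝ_
infixl 7 _*ℝ_

_+ℝ_ : ℝ → ℝ → ℝ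
seq      (x +ℝ y) k = seq x k ℚ.+ seq y k
isCauchy (x +ℝ y) ε 0<ε
  with isCauchy x (½ ℚ.* ε) (0<½* 0<ε) | isCauchy y (½ ℚ.* ε) (0<½* 0<ε)
... | N₁ , h₁ | N₂ , h₂ = N₁ ℕ.⊔ N₂ , λ m k N≤m N≤k →
  ℚ.≤-<-trans (∣-∣-+ (seq x m) (seq y m) (seq x k) (seq y k))
    (subst (_ ℚ.<_) (½*+½* ε)
      (ℚ.+-mono-<
        (h₁ m k (ℕ.m⊔n≤o⇒m≤o N₁ N₂ N≤m) (ℕ.m⊔n≤o⇒m≤o N₁ N₂ N≤k))
        (h₂ m k (ℕ.m⊔n≤o⇒n≤o N₁ N₂ N≤m) (ℕ.m⊔n≤o⇒n≤o N₁ N₂ N≤k))))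

module Bounds where
  EventuallyBelow : ℚ → (ℕ → ℚ) → Set
  EventuallyBelow B x = ∃[ N ] (∀ k → N ℕ.≤ k → ∣ x k ∣ ℚ.< B)

  eventuallyBounded : ∀ x → ∃[ B ] EventuallyBelow B (seq x)
  eventuallyBounded x with isCauchy x 1ℚ (ℚ.positive⁻¹ 1ℚ)
  ... | N , h = 1ℚ ℚ.+ ∣ seq x N ∣ , N , λ k N≤k →
    ℚ.≤-<-trans
      (subst (λ t → ∣ t ∣ ℚ.≤ ∣ seq x k ℚ.- seq x N ∣ ℚ.+ ∣ seq x N ∣)
        (minus-plus (seq x k) (seq x N))
        (ℚ.∣p+q∣≤∣p∣+∣q∣ (seq x k ℚ.- seq x N) (seq x N)))
      (ℚ.+-monoˡ-< ∣ seq x N ∣ (h k N N≤k ℕ.≤-refl))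

  EventuallyWithin : ℚ → (ℕ → ℚ) → Set
  EventuallyWithin ε x = ∃[ N ] (∀ m k → N ℕ.≤ m → N ℕ.≤ k → ∣ x m ℚ.- x k ∣ ℚ.< ε)

  weaken : ∀ {B C x} → B ℚ.≤ C → EventuallyBelow B x → EventuallyBelow C x
  weaken B≤C (N , h) = N , λ k N≤k → ℚ.<-≤-trans (h k N≤k) B≤C

  positiveBound : ∀ {B x} → EventuallyBelow B x → 0ℚ ℚ.< B
  positiveBound {x = x} (N , h) = ℚ.≤-<-trans (ℚ.0≤∣p∣ (x N)) (h N ℕ.≤-refl)

  *-within : ∀ (x y : ℕ → ℚ) B δ ε → 0ℚ ℚ.< δ → B ℚ.* δ ≡ ½ ℚ.* ε →
             EventuallyBelow B x → EventuallyBelow B y →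
             EventuallyWithin δ x → EventuallyWithin δ y →
             EventuallyWithin ε (λ k → x k ℚ.* y k)
  *-within x y B δ ε 0<δ B*δ (N₁ , h₁) (N₂ , h₂) (N₃ , h₃) (N₄ , h₄) =
    (N₁ ℕ.⊔ N₂) ℕ.⊔ (N₃ ℕ.⊔ N₄) , λ m k N≤m N≤k →
      ∣-∣-*-< (x m) (y m) (x k) (y k) B δ ε 0<δ B*δ
        (h₁ m (ℕ.m⊔n≤o⇒m≤o N₁ N₂ (N₁₂≤ m N≤m)))
        (h₂ k (ℕ.m⊔n≤o⇒n≤o N₁ N₂ (N₁₂≤ k N≤k)))
        (h₃ m k (ℕ.m⊔n≤o⇒m≤o N₃ N₄ (N₃₄≤ m N≤m)) (ℕ.m⊔n≤o⇒m≤o N₃ N₄ (N₃₄≤ k N≤k)))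
        (h₄ m k (ℕ.m⊔n≤o⇒n≤o N₃ N₄ (N₃₄≤ m N≤m)) (ℕ.m⊔n≤o⇒n≤o N₃ N₄ (N₃₄≤ k N≤k)))
    where
    N₁₂≤ : ∀ k → (N₁ ℕ.⊔ N₂) ℕ.⊔ (N₃ ℕ.⊔ N₄) ℕ.≤ k → N₁ ℕ.⊔ N₂ ℕ.≤ k
    N₁₂≤ k = ℕ.m⊔n≤o⇒m≤o (N₁ ℕ.⊔ N₂) (N₃ ℕ.⊔ N₄)
    N₃₄≤ : ∀ k → (N₁ ℕ.⊔ N₂) ℕ.⊔ (N₃ ℕ.⊔ N₄) ℕ.≤ k → N₃ ℕ.⊔ N₄ ℕ.≤ k
    N₃₄≤ k = ℕ.m⊔n≤o⇒n≤o (N₁ ℕ.⊔ N₂) (N₃ ℕ.⊔ N₄)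

  *-isCauchy : ∀ x y → IsCauchy (λ k → seq x k ℚ.* seq y k)
  *-isCauchy x y ε 0<ε = combine (eventuallyBounded x) (eventuallyBounded y)
    where
    combine : ∃[ B ] EventuallyBelow B (seq x) → ∃[ B ] EventuallyBelow B (seq y) →
              EventuallyWithin ε (λ k → seq x k ℚ.* seq y k)
    combine (B₁ , b₁) (B₂ , b₂) = finish (divide B (½ ℚ.* ε) (positiveBound b₁′) (0<½* 0<ε))
      where
      B : ℚ
      B = B₁ ℚ.⊔ B₂
      b₁′ : EventuallyBelow B (seq x)
      b₁′ = weaken {x = seq x} (ℚ.p≤p⊔q B₁ B₂) b₁
      b₂′ : EventuallyBelow B (seq y)
      b₂′ = weaken {x = seq y} (ℚ.p≤q⊔p B₁ B₂) b₂
      finish : ∃[ δ ] (0ℚ ℚ.< δ × B ℚ.* δ ≡ ½ ℚ.* ε) →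
               EventuallyWithin ε (λ k → seq x k ℚ.* seq y k)
      finish (δ , 0<δ , B*δ) =
        *-within (seq x) (seq y) B δ ε 0<δ B*δ b₁′ b₂′ (isCauchy x δ 0<δ) (isCauchy y δ 0<δ)

open Bounds public

_*ℝ_ : ℝ → ℝ → ℝ
seq      (x *ℝ y) k = seq x k ℚ.* seq y k
isCauchy (x *ℝ y)   = *-isCauchy x y

record Subset (S : Setoid c ℓ) (p : Level) : Set (c ⊔ ℓ ⊔ lsuc p) where
  open Setoid S
  field
    member   : Pred Carrier p
    respects : member Respects _≈_

infix 4 _∈_ _⊆_

_∈_ : {S : Setoid c ℓ} → Setoid.Carrier S → Subset S p → Set p
x ∈ X = Subset.member X x

_⊆_ : {S : Setoid c ℓ} {q : Level} → Subset S p → Subset S q → Set (c ⊔ p ⊔ q)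
X ⊆ Y = ∀ x → x ∈ X → x ∈ Y

elements : {S : Setoid c ℓ} → Subset S p → Setoid (c ⊔ p) ℓ
elements {S = S} X = On.setoid S (proj₁ {B = _∈ X})

infix 4 _HasCardinality_ _HasCardinality≤_

_HasCardinality_ : {S : Setoid c ℓ} → Subset S p → ℕ → Set (c ⊔ ℓ ⊔ p)
X HasCardinality m = Bijection (≡-setoid (Fin m)) (elements X)

-- A subset of a finite set need not come with an enumeration
-- constructively, so an upper bound on its cardinality is a bound on the
-- number of terms of any family of pairwise distinct elements.
_HasCardinality≤_ : {S : Setoid c ℓ} → Subset S p → ℕ → Set (c ⊔ ℓ ⊔ p)
X HasCardinality≤ m = ∀ k → Injection (≡-setoid (Fin k)) (elements X) → k ℕ.≤ m

ℝ^ : ℕ → Setoid 0ℓ 0ℓ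
ℝ^ n = ≋-setoid ℝ-setoid n

infix 4 _≋ℝ_

_≋ℝ_ : ∀ {n} → Vector ℝ n → Vector ℝ n → Set
_≋ℝ_ {n} = Setoid._≈_ (ℝ^ n)

⟨_,_⟩ : ∀ {n} → Vector ℝ n → Vector ℝ n → ℝ
⟨ x , y ⟩ = foldr _+ℝ_ 0ℝ (zipWith _*ℝ_ x y)

box : ∀ {n} → (Fin n → Subset ℝ-setoid a) → Subset (ℝ^ n) a
box A = record
  { member   = λ x → ∀ i → x i ∈ A i
  ; respects = λ x≋y x∈A i → Subset.respects (A i) (x≋y i) (x∈A i)
  }

scalarProducts : ∀ {n} → Subset (ℝ^ n) p → Subset ℝ-setoid p
scalarProducts G = record
  { member   = λ r → ∃[ p₁ ] ∃[ p₂ ]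
                 (p₁ ∈ G × p₂ ∈ G × ¬ (p₁ ≋ℝ p₂) × r ≈ℝ ⟨ p₁ , p₂ ⟩)
  ; respects = λ { r≈r′ (p₁ , p₂ , p₁∈G , p₂∈G , p₁≉p₂ , r≈) →
                 p₁ , p₂ , p₁∈G , p₂∈G , p₁≉p₂ , ≈ℝ-trans (≈ℝ-sym r≈r′) r≈ }
  }

-- x₁^α₁ ⋯ xₙ^αₙ is represented by its exponent vector α.
Monomial : ℕ → Setoid 0ℓ 0ℓ
Monomial n = ≋-setoid (≡-setoid ℕ) n

degree : ∀ {n} → Setoid.Carrier (Monomial n) → ℕ
degree α = foldr ℕ._+_ 0 α

degree-cong : ∀ {n} {α β : Setoid.Carrier (Monomial n)} →
              Setoid._≈_ (Monomial n) α β → degree α ≡ degree β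
degree-cong {ℕ.zero}  _   = refl
degree-cong {ℕ.suc n} α≋β = cong₂ ℕ._+_ (α≋β Fin.zero) (degree-cong (λ i → α≋β (Fin.suc i)))

monomials : (n q s : ℕ) → Subset (Monomial n) 0ℓ
monomials n q s = record
  { member   = λ α → (∀ i → α i ℕ.≤ q ℕ.∸ 1) × degree α ℕ.≤ s
  ; respects = λ { α≋β (α≤q-1 , ∣α∣≤s) →
                 (λ i → subst (ℕ._≤ q ℕ.∸ 1) (α≋β i) (α≤q-1 i)) ,
                 subst (ℕ._≤ s) (degree-cong α≋β) ∣α∣≤s }
  }

{-# OPTIONS --safe #-}
module Submission where

-- If d₁, …, d_t (t ≤ s) are the scalar products occurring in F, then the
-- polynomials ∏ⱼ (⟨f , x⟩ − dⱼ), f ∈ F, have degree at most s, vanish at every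
-- point of F other than f, and do not vanish at f; hence they are linearly
-- independent as functions on F. On the box they are combinations of the
-- Newton products ∏ₗ ∏_{t<αₗ} (xₗ − a_{l,t}) with |α| ≤ s, where
-- a_{l,0}, …, a_{l,q−1} are the elements of Aₗ. These serve better than the
-- monomials x^α: multiplication by xₗ is a two-term recurrence, and the product
-- is zero on the box as soon as some αₗ ≥ q.
--
-- Equality of reals is undecidable, but the bound on |F| is a decidable
-- inequality, so dependent vectors and the list of the dⱼ are needed only up to
-- double negation.

open import Defs
open import Algebra.Bundles using (CommutativeRing)
import Algebra.Properties.AbelianGroup as AbelianGroupProperties
import Algebra.Properties.CommutativeSemigroup as CommutativeSemigroupProperties
import Algebra.Properties.Ring as RingProperties
import Algebra.Properties.Semiring.Sum as SemiringSum
open import Data.Empty using (⊥)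
open import Data.Fin.Base using
  (Fin; zero; suc; toℕ; fromℕ<; punchIn; inject≤; combine; funToFin; finToFun)
import Data.Fin.Properties as Fin
open import Data.List.Base using
  (List; []; _∷_; length; foldr; lookup; map; filter; allFin; applyDownFrom)
import Data.List.Membership.Propositional.Properties as ∈
import Data.List.Membership.Setoid as Membership
import Data.List.Membership.Setoid.Properties as ∈ₛ
open import Data.List.Properties using (length-map)
open import Data.List.Relation.Unary.All as All using (All; []; _∷_)
import Data.List.Relation.Unary.All.Properties as All
open import Data.List.Relation.Unary.AllPairs using ([]; _∷_)
open import Data.List.Relation.Unary.Any as Any using (Any; here; there)
import Data.List.Relation.Unary.Any.Properties as Any
import Data.List.Relation.Unary.Unique.Propositional.Properties as Unique
open import Data.List.Relation.Unary.Unique.Setoid using (Unique)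
open import Data.Nat.Base as ℕ using (ℕ; _≤_; _^_)
import Data.Nat.Properties as ℕ
open import Data.Product.Base using (Σ-syntax; ∃-syntax; _×_; _,_; proj₁; proj₂)
open import Data.Rational.Base as ℚ using (ℚ; 0ℚ; 1ℚ; ½; ∣_∣)
import Data.Rational.Properties as ℚ
open import Data.Sum.Base using (_⊎_; inj₁; inj₂)
open import Data.Vec.Functional as Vector using (Vector; insertAt; updateAt)
open import Data.Vec.Functional.Properties using (insertAt-lookup; insertAt-punchIn)
open import Function.Base using (_∘_)
open import Function.Bundles using (Bijection; Injection)
open import Level using (Level; 0ℓ; _⊔_)
open import Relation.Binary.Bundles using (Setoid)
open import Relation.Binary.PropositionalEquality as ≡ using (_≡_; _≢_; _≗_)
import Relation.Binary.Reasoning.Setoid as SetoidReasoning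
open import Relation.Nullary.Decidable using (yes; no; toWitness; ¬¬-excluded-middle)
open import Relation.Nullary.Negation using (¬_; contradiction; ¬¬-map; Stable)

-- The commutative ring of reals.

≗⇒≈ℝ : ∀ {x y} → (∀ k → seq x k ≡ seq y k) → x ≈ℝ y
close (≗⇒≈ℝ {x} {y} x≗y) ε 0<ε = 0 , λ k _ →
  ≡.subst (ℚ._< ε) (≡.sym (≡.trans (≡.cong (λ t → ∣ t ℚ.- seq y k ∣) (x≗y k))
                             (≡.cong ∣_∣ (ℚ.+-inverseʳ (seq y k))))) 0<ε

1ℝ : ℝ
1ℝ = fromℚ 1ℚ

-‿minus : ∀ u v → (ℚ.- u) ℚ.- (ℚ.- v) ≡ ℚ.- (u ℚ.- v)
-‿minus u v = ≡.sym (ℚ.neg-distrib-+ u (ℚ.- v))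

∣-‿minus∣ : ∀ u v → ∣ (ℚ.- u) ℚ.- (ℚ.- v) ∣ ≡ ∣ u ℚ.- v ∣
∣-‿minus∣ u v = ≡.trans (≡.cong ∣_∣ (-‿minus u v)) (ℚ.∣-p∣≡∣p∣ (u ℚ.- v))

-ℝ_ : ℝ → ℝ
seq      (-ℝ x) k = ℚ.- seq x k
isCauchy (-ℝ x) ε 0<ε with isCauchy x ε 0<ε
... | N , h = N , λ m k N≤m N≤k →
  ≡.subst (ℚ._< ε) (≡.sym (∣-‿minus∣ (seq x m) (seq x k))) (h m k N≤m N≤k)

-ℝ-cong : ∀ {x y} → x ≈ℝ y → -ℝ x ≈ℝ -ℝ y
close (-ℝ-cong {x} {y} x≈y) ε 0<ε with close x≈y ε 0<ε
... | N , h = N , λ k N≤k →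
  ≡.subst (ℚ._< ε) (≡.sym (∣-‿minus∣ (seq x k) (seq y k))) (h k N≤k)

+ℝ-cong : ∀ {x x′ y y′} → x ≈ℝ x′ → y ≈ℝ y′ → x +ℝ y ≈ℝ x′ +ℝ y′
close (+ℝ-cong {x} {x′} {y} {y′} x≈x′ y≈y′) ε 0<ε
  with close x≈x′ (½ ℚ.* ε) (0<½* 0<ε) | close y≈y′ (½ ℚ.* ε) (0<½* 0<ε)
... | N₁ , h₁ | N₂ , h₂ = N₁ ℕ.⊔ N₂ , λ k N≤k →
  ℚ.≤-<-trans (∣-∣-+ (seq x k) (seq y k) (seq x′ k) (seq y′ k))
    (≡.subst (_ ℚ.<_) (½*+½* ε)
      (ℚ.+-mono-< (h₁ k (ℕ.m⊔n≤o⇒m≤o N₁ N₂ N≤k)) (h₂ k (ℕ.m⊔n≤o⇒n≤o N₁ N₂ N≤k))))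

-- The difference of products is `x (y - y′) + y′ (x - x′)`, so bounds are needed for `x` and `y′`
-- only, and each summand is eventually below `B * δ`, half of `ε`.
*-close : ∀ (x y x′ y′ : ℕ → ℚ) B δ ε → 0ℚ ℚ.< δ → B ℚ.* δ ≡ ½ ℚ.* ε →
          EventuallyBelow B x → EventuallyBelow B y′ →
          EventuallyBelow δ (λ k → x k ℚ.- x′ k) → EventuallyBelow δ (λ k → y k ℚ.- y′ k) →
          EventuallyBelow ε (λ k → x k ℚ.* y k ℚ.- x′ k ℚ.* y′ k)
*-close x y x′ y′ B δ ε 0<δ B*δ (N₁ , h₁) (N₂ , h₂) (N₃ , h₃) (N₄ , h₄) =
  (N₁ ℕ.⊔ N₂) ℕ.⊔ (N₃ ℕ.⊔ N₄) , λ k N≤k →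
    ∣-∣-*-< (x k) (y k) (x′ k) (y′ k) B δ ε 0<δ B*δ
      (h₁ k (ℕ.m⊔n≤o⇒m≤o N₁ N₂ (N₁₂≤ k N≤k)))
      (h₂ k (ℕ.m⊔n≤o⇒n≤o N₁ N₂ (N₁₂≤ k N≤k)))
      (h₃ k (ℕ.m⊔n≤o⇒m≤o N₃ N₄ (N₃₄≤ k N≤k)))
      (h₄ k (ℕ.m⊔n≤o⇒n≤o N₃ N₄ (N₃₄≤ k N≤k)))
  where
  N₁₂≤ : ∀ k → (N₁ ℕ.⊔ N₂) ℕ.⊔ (N₃ ℕ.⊔ N₄) ℕ.≤ k → N₁ ℕ.⊔ N₂ ℕ.≤ k
  N₁₂≤ k = ℕ.m⊔n≤o⇒m≤o (N₁ ℕ.⊔ N₂) (N₃ ℕ.⊔ N₄)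
  N₃₄≤ : ∀ k → (N₁ ℕ.⊔ N₂) ℕ.⊔ (N₃ ℕ.⊔ N₄) ℕ.≤ k → N₃ ℕ.⊔ N₄ ℕ.≤ k
  N₃₄≤ k = ℕ.m⊔n≤o⇒n≤o (N₁ ℕ.⊔ N₂) (N₃ ℕ.⊔ N₄)

*ℝ-cong : ∀ {x x′ y y′} → x ≈ℝ x′ → y ≈ℝ y′ → x *ℝ y ≈ℝ x′ *ℝ y′
close (*ℝ-cong {x} {x′} {y} {y′} x≈x′ y≈y′) ε 0<ε =
  fromBounds (eventuallyBounded x) (eventuallyBounded y′)
  where
  fromBounds : ∃[ B ] EventuallyBelow B (seq x) → ∃[ B ] EventuallyBelow B (seq y′) →
            EventuallyBelow ε (λ k → seq x k ℚ.* seq y k ℚ.- seq x′ k ℚ.* seq y′ k)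
  fromBounds (B₁ , b₁) (B₂ , b₂) = finish (divide B (½ ℚ.* ε) (positiveBound {x = seq x} b₁′) (0<½* 0<ε))
    where
    B : ℚ
    B = B₁ ℚ.⊔ B₂
    b₁′ : EventuallyBelow B (seq x)
    b₁′ = weaken {x = seq x} (ℚ.p≤p⊔q B₁ B₂) b₁
    b₂′ : EventuallyBelow B (seq y′)
    b₂′ = weaken {x = seq y′} (ℚ.p≤q⊔p B₁ B₂) b₂
    finish : ∃[ δ ] (0ℚ ℚ.< δ × B ℚ.* δ ≡ ½ ℚ.* ε) →
             EventuallyBelow ε (λ k → seq x k ℚ.* seq y k ℚ.- seq x′ k ℚ.* seq y′ k)
    finish (δ , 0<δ , B*δ) = *-close (seq x) (seq y) (seq x′) (seq y′) B δ ε 0<δ B*δ b₁′ b₂′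
      (close x≈x′ δ 0<δ) (close y≈y′ δ 0<δ)

-- The ring laws hold term by term in `ℚ`; only the congruences require estimates.
ℝ-commutativeRing : CommutativeRing 0ℓ 0ℓ
ℝ-commutativeRing = record
  { Carrier = ℝ
  ; _≈_     = _≈ℝ_
  ; _+_     = _+ℝ_
  ; _*_     = _*ℝ_
  ; -_      = -ℝ_
  ; 0#      = 0ℝ
  ; 1#      = 1ℝ
  ; isCommutativeRing = record
    { isRing = record
      { +-isAbelianGroup = record
        { isGroup = record
          { isMonoid = record
            { isSemigroup = record
              { isMagma = record
                { isEquivalence = record { refl = ≈ℝ-refl ; sym = ≈ℝ-sym ; trans = ≈ℝ-trans }
                ; ∙-cong        = +ℝ-cong
                }
              ; assoc = λ x y z → ≗⇒≈ℝ λ k → ℚ.+-assoc (seq x k) (seq y k) (seq z k)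
              }
            ; identity = (λ x → ≗⇒≈ℝ λ k → ℚ.+-identityˡ (seq x k))
                       , (λ x → ≗⇒≈ℝ λ k → ℚ.+-identityʳ (seq x k))
            }
          ; inverse = (λ x → ≗⇒≈ℝ λ k → ℚ.+-inverseˡ (seq x k))
                    , (λ x → ≗⇒≈ℝ λ k → ℚ.+-inverseʳ (seq x k))
          ; ⁻¹-cong = -ℝ-cong
          }
        ; comm = λ x y → ≗⇒≈ℝ λ k → ℚ.+-comm (seq x k) (seq y k)
        }
      ; *-cong     = *ℝ-cong
      ; *-assoc    = λ x y z → ≗⇒≈ℝ λ k → ℚ.*-assoc (seq x k) (seq y k) (seq z k)
      ; *-identity = (λ x → ≗⇒≈ℝ λ k → ℚ.*-identityˡ (seq x k))
                   , (λ x → ≗⇒≈ℝ λ k → ℚ.*-identityʳ (seq x k))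
      ; distrib    = (λ x y z → ≗⇒≈ℝ λ k → ℚ.*-distribˡ-+ (seq x k) (seq y k) (seq z k))
                   , (λ x y z → ≗⇒≈ℝ λ k → ℚ.*-distribʳ-+ (seq x k) (seq y k) (seq z k))
      }
    ; *-comm = λ x y → ≗⇒≈ℝ λ k → ℚ.*-comm (seq x k) (seq y k)
    }
  }

-- Apartness from zero and the absence of zero divisors.

AwayFrom0 : ℝ → Set
AwayFrom0 x = ∃[ δ ] (0ℚ ℚ.< δ × ∃[ N ] (∀ k → N ℕ.≤ k → δ ℚ.< ∣ seq x k ∣))

-- The alternatives overlap, so one rational comparison decides: past the Cauchy index `N` for
-- `η = ε / 4`, test `∣ seq x N ∣` against `δ = ε / 2`. If it is smaller, later terms stay below
-- `δ + δ = ε`; if not, a later term of size at most `η` would force `∣ seq x N ∣ < η + η = δ`.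
small-or-away : ∀ x ε → 0ℚ ℚ.< ε → EventuallyBelow ε (seq x) ⊎ AwayFrom0 x
small-or-away x ε 0<ε = decide (isCauchy x η 0<η)
  where
  δ η : ℚ
  δ = ½ ℚ.* ε
  η = ½ ℚ.* δ
  0<η : 0ℚ ℚ.< η
  0<η = 0<½* (0<½* 0<ε)
  η<δ : η ℚ.< δ
  η<δ = ℚ.<-respˡ-≡ (ℚ.+-identityʳ η) (ℚ.<-respʳ-≡ (½*+½* δ) (ℚ.+-monoʳ-< η 0<η))

  decide : EventuallyWithin η (seq x) → EventuallyBelow ε (seq x) ⊎ AwayFrom0 x
  decide (N , h) with ∣ seq x N ∣ ℚ.<? δ
  ... | yes ∣xN∣<δ = inj₁ (N , λ k N≤k → begin-strict
    ∣ seq x k ∣                              ≡⟨ ≡.cong ∣_∣ (minus-plus (seq x k) (seq x N)) ⟨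
    ∣ (seq x k ℚ.- seq x N) ℚ.+ seq x N ∣    ≤⟨ ℚ.∣p+q∣≤∣p∣+∣q∣ (seq x k ℚ.- seq x N) (seq x N) ⟩
    ∣ seq x k ℚ.- seq x N ∣ ℚ.+ ∣ seq x N ∣  <⟨ ℚ.+-mono-< (ℚ.<-trans (h k N N≤k ℕ.≤-refl) η<δ) ∣xN∣<δ ⟩
    δ ℚ.+ δ                                  ≡⟨ ½*+½* ε ⟩
    ε                                        ∎)
    where open ℚ.≤-Reasoning
  ... | no ∣xN∣≮δ = inj₂ (η , 0<η , N , λ k N≤k → ℚ.≰⇒> λ ∣xk∣≤η → ∣xN∣≮δ (begin-strict
    ∣ seq x N ∣                              ≡⟨ ≡.cong ∣_∣ (minus-plus (seq x N) (seq x k)) ⟨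
    ∣ (seq x N ℚ.- seq x k) ℚ.+ seq x k ∣    ≤⟨ ℚ.∣p+q∣≤∣p∣+∣q∣ (seq x N ℚ.- seq x k) (seq x k) ⟩
    ∣ seq x N ℚ.- seq x k ∣ ℚ.+ ∣ seq x k ∣  <⟨ ℚ.+-mono-<-≤ (h N k ℕ.≤-refl N≤k) ∣xk∣≤η ⟩
    η ℚ.+ η                                  ≡⟨ ½*+½* δ ⟩
    δ                                        ∎))
    where open ℚ.≤-Reasoning

AwayFrom0⇒≉0 : ∀ {x} → AwayFrom0 x → ¬ x ≈ℝ 0ℝ
AwayFrom0⇒≉0 {x} (δ , 0<δ , N₁ , h₁) x≈0 with close x≈0 δ 0<δ
... | N₂ , h₂ = ℚ.<-asym (h₁ N (ℕ.m≤m⊔n N₁ N₂))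
  (≡.subst (λ t → ∣ t ∣ ℚ.< δ) (ℚ.+-identityʳ (seq x N)) (h₂ N (ℕ.m≤n⊔m N₁ N₂)))
  where N = N₁ ℕ.⊔ N₂

-- For every `ε`, the second alternative of `small-or-away` is excluded. Together with
-- `AwayFrom0⇒≉0` this makes equality to zero equivalent to a negation, hence stable.
¬AwayFrom0⇒≈0 : ∀ {x} → ¬ AwayFrom0 x → x ≈ℝ 0ℝ
close (¬AwayFrom0⇒≈0 {x} ¬away) ε 0<ε with small-or-away x ε 0<ε
... | inj₁ (N , h) = N , λ k N≤k → ≡.subst (λ t → ∣ t ∣ ℚ.< ε) (≡.sym (ℚ.+-identityʳ (seq x k))) (h k N≤k)
... | inj₂ away    = contradiction away ¬away

≈ℝ0-stable : ∀ {x} → Stable (x ≈ℝ 0ℝ)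
≈ℝ0-stable ¬¬x≈0 = ¬AwayFrom0⇒≈0 λ away → ¬¬x≈0 (AwayFrom0⇒≉0 away)

1ℝ≉0 : ¬ 1ℝ ≈ℝ 0ℝ
1ℝ≉0 = AwayFrom0⇒≉0 (½ , ℚ.positive⁻¹ ½ , 0 , λ _ _ → toWitness {a? = ½ ℚ.<? 1ℚ} _)

AwayFrom0-* : ∀ {x y} → AwayFrom0 x → AwayFrom0 y → AwayFrom0 (x *ℝ y)
AwayFrom0-* {x} {y} (δ₁ , 0<δ₁ , N₁ , h₁) (δ₂ , 0<δ₂ , N₂ , h₂) =
  δ₁ ℚ.* δ₂ , ℚ.positive⁻¹ _ {{ℚ.pos*pos⇒pos δ₁ {{ℚ.positive 0<δ₁}} δ₂ {{ℚ.positive 0<δ₂}}}} ,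
  N₁ ℕ.⊔ N₂ , λ k N≤k → begin-strict
    δ₁ ℚ.* δ₂                   <⟨ ℚ.*-monoˡ-<-pos δ₂ {{ℚ.positive 0<δ₂}} (h₁ k (ℕ.m⊔n≤o⇒m≤o N₁ N₂ N≤k)) ⟩
    ∣ seq x k ∣ ℚ.* δ₂          ≤⟨ ℚ.*-monoˡ-≤-nonNeg ∣ seq x k ∣ {{ℚ.∣-∣-nonNeg (seq x k)}}
                                     (ℚ.<⇒≤ (h₂ k (ℕ.m⊔n≤o⇒n≤o N₁ N₂ N≤k))) ⟩
    ∣ seq x k ∣ ℚ.* ∣ seq y k ∣ ≡⟨ ℚ.∣p*q∣≡∣p∣*∣q∣ (seq x k) (seq y k) ⟨
    ∣ seq x k ℚ.* seq y k ∣     ∎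
  where open ℚ.≤-Reasoning

-- From `x ≉ 0` no explicit lower bound on the size of `x` can be extracted, only the double
-- negation of `AwayFrom0 x`. That is enough here, because the goal is itself a contradiction.
*ℝ-≉0 : ∀ {x y} → ¬ x ≈ℝ 0ℝ → ¬ y ≈ℝ 0ℝ → ¬ x *ℝ y ≈ℝ 0ℝ
*ℝ-≉0 {x} {y} x≉0 y≉0 xy≈0 =
  x≉0 (¬AwayFrom0⇒≈0 λ away-x → y≉0 (¬AwayFrom0⇒≈0 λ away-y →
    AwayFrom0⇒≉0 (AwayFrom0-* {x} {y} away-x away-y) xy≈0))

-- Linear algebra and Newton products over an integral domain.

record IsIntegralDomain {c ℓ} (R : CommutativeRing c ℓ) : Set (c ⊔ ℓ) where
  open CommutativeRing R
  field
    1≉0       : ¬ 1# ≈ 0#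
    *-≉0      : ∀ {x y} → ¬ x ≈ 0# → ¬ y ≈ 0# → ¬ x * y ≈ 0#
    -- Stands in for decidable equality: an element vanishes once its being nonzero is refuted.
    ≈0-stable : ∀ {x} → Stable (x ≈ 0#)

ℝ-isIntegralDomain : IsIntegralDomain ℝ-commutativeRing
ℝ-isIntegralDomain = record { 1≉0 = 1ℝ≉0 ; *-≉0 = *ℝ-≉0 ; ≈0-stable = ≈ℝ0-stable }

module IntegralDomain {c ℓ} (R : CommutativeRing c ℓ) (domain : IsIntegralDomain R) where

  open CommutativeRing R hiding (zero)
  open IsIntegralDomain domain
  open SemiringSum semiring
  open Membership setoid renaming (_∈_ to _∈ˡ_)
  open AbelianGroupProperties +-abelianGroup using (x≈y⇒x∙y⁻¹≈ε; x∙y⁻¹≈ε⇒x≈y)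
  open RingProperties ring using (-‿distribˡ-*; -‿distribʳ-*)
  open CommutativeSemigroupProperties *-commutativeSemigroup using (x∙yz≈y∙xz)
  open SetoidReasoning setoid

  sum-zero : ∀ {n} {t : Vector Carrier n} → (∀ i → t i ≈ 0#) → sum t ≈ 0#
  sum-zero {n} t≈0 = trans (sum-cong-≋ t≈0) (sum-replicate-zero n)

  -- Linear dependence

  NonTrivial : ∀ {n} → Vector Carrier n → Set ℓ
  NonTrivial c = ∃[ i ] ¬ c i ≈ 0#

  -- Fraction-free elimination of the first coordinate with pivot vector v i.
  module Pivot {m n} (v : Fin (ℕ.suc n) → Vector Carrier (ℕ.suc m)) (i : Fin (ℕ.suc n)) where
    pivot : Carrier
    pivot = v i zero

    others : Fin n → Vector Carrier (ℕ.suc m)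
    others = v ∘ punchIn i

    reduced : Fin n → Vector Carrier (ℕ.suc m)
    reduced j t = pivot * others j t + - (others j zero * v i t)

    module _ (c : Vector Carrier n) where
      S : Carrier
      S = sum (λ j → c j * others j zero)

      -- Turns coefficients for the reduced vectors into coefficients for the original ones. Each
      -- reduced vector contributes `pivot` times one of the `others`, and the multiples of `v i`
      -- that the reduction subtracts add up to `S`.
      lift : Vector Carrier (ℕ.suc n)
      lift = insertAt (λ j → c j * pivot) i (- S)

      lift-relation : ∀ t → sum (λ k → lift k * v k t) ≈ sum (λ j → c j * reduced j t)
      lift-relation t = begin
        sum (λ k → lift k * v k t)
          ≈⟨ sum-remove {i = i} (λ k → lift k * v k t) ⟩
        lift i * v i t + sum (λ j → lift (punchIn i j) * others j t)
          ≈⟨ +-cong (*-congʳ (reflexive (insertAt-lookup _ i _)))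
                    (sum-cong-≋ λ j → *-congʳ (reflexive (insertAt-punchIn _ i _ j))) ⟩
        - S * v i t + sum (λ j → c j * pivot * others j t)
          ≈⟨ +-comm _ _ ⟩
        sum (λ j → c j * pivot * others j t) + - S * v i t
          ≈⟨ +-congˡ (trans (sym (-‿distribˡ-* S (v i t))) (-‿distribʳ-* S (v i t))) ⟩
        sum (λ j → c j * pivot * others j t) + S * - v i t
          ≈⟨ +-congˡ (*-distribʳ-sum (- v i t) (λ j → c j * others j zero)) ⟩
        sum (λ j → c j * pivot * others j t) + sum (λ j → c j * others j zero * - v i t)
          ≈⟨ ∑-distrib-+ (λ j → c j * pivot * others j t) (λ j → c j * others j zero * - v i t) ⟨
        sum (λ j → c j * pivot * others j t + c j * others j zero * - v i t)
          ≈⟨ sum-cong-≋ (λ j → trans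
               (+-cong (*-assoc (c j) pivot (others j t))
                       (trans (*-assoc (c j) (others j zero) (- v i t))
                              (*-congˡ (sym (-‿distribʳ-* (others j zero) (v i t))))))
               (sym (distribˡ (c j) (pivot * others j t) (- (others j zero * v i t))))) ⟩
        sum (λ j → c j * reduced j t) ∎

    reduced-zero : ∀ j → reduced j zero ≈ 0#
    reduced-zero j = x≈y⇒x∙y⁻¹≈ε (*-comm pivot (others j zero))

  -- Induction on the dimension: eliminating the first coordinate costs one vector and one
  -- coordinate.
  linearlyDependent : ∀ m (v : Fin (ℕ.suc m) → Vector Carrier m) →
    ¬ ¬ (∃[ c ] (NonTrivial c × ∀ t → sum (λ k → c k * v k t) ≈ 0#))
  linearlyDependent ℕ.zero    v ¬dep = ¬dep ((λ _ → 1#) , (zero , 1≉0) , λ ())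
  linearlyDependent (ℕ.suc m) v ¬dep =
    -- The existence of a pivot is undecidable, but the goal is `⊥`, so both cases may be treated.
    ¬¬-excluded-middle {A = ∃[ i ] ¬ v i zero ≈ 0#} λ where
      (yes (i , vi0≉0)) → let open Pivot v i in
        linearlyDependent m (λ j → reduced j ∘ suc) λ where
          (c , (j , cj≉0) , rel) → ¬dep
            ( lift c
            -- The lifted coefficient is `c j * pivot`, a product of two nonzero elements.
            , (punchIn i j , λ lift≈0 → *-≉0 cj≉0 vi0≉0
                (trans (reflexive (≡.sym (insertAt-punchIn _ i _ j))) lift≈0))
            , λ t → trans (lift-relation c t) (reduced-relation v i c rel t))
      (no ¬pivot) → linearlyDependent m (λ j → v (suc j) ∘ suc) λ where
        (c , (j , cj≉0) , rel) → ¬dep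
          ( 0# Vector.∷ c
          , (suc j , cj≉0)
          , λ { zero    → sum-zero λ k →
                  trans (*-congˡ (≈0-stable λ vk0≉0 → ¬pivot (k , vk0≉0))) (zeroʳ ((0# Vector.∷ c) k))
              ; (suc t) → trans (+-cong (zeroˡ _) (rel t)) (+-identityˡ 0#) })
    where
    reduced-relation : ∀ v i c → let open Pivot v i in
      (∀ t → sum (λ j → c j * reduced j (suc t)) ≈ 0#) → ∀ t → sum (λ j → c j * reduced j t) ≈ 0#
    reduced-relation v i c rel zero    = sum-zero λ j →
      trans (*-congˡ (Pivot.reduced-zero v i j)) (zeroʳ (c j))
    reduced-relation v i c rel (suc t) = rel t

  -- Linear combinations of functions

  module _ {x} {X : Set x} where

    IsCombination : ∀ {m} → (Fin m → X → Carrier) → (X → Carrier) → Set (c ⊔ ℓ ⊔ x)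
    IsCombination {m} b g = Σ[ u ∈ Vector Carrier m ] (∀ i → g i ≈ sum (λ j → u j * b j i))

    combination-zero : ∀ {m g} (b : Fin m → X → Carrier) → (∀ i → g i ≈ 0#) → IsCombination b g
    combination-zero b g≈0 = (λ _ → 0#) , λ i → trans (g≈0 i) (sym (sum-zero λ j → zeroˡ (b j i)))

    combination-single : ∀ {m g} (b : Fin m → X → Carrier) k → (∀ i → g i ≈ b k i) → IsCombination b g
    combination-single {ℕ.suc m} b k g≈b = insertAt (λ _ → 0#) k 1# , λ i → begin
      _                                              ≈⟨ g≈b i ⟩
      b k i                                          ≈⟨ *-identityˡ (b k i) ⟨
      1# * b k i                                     ≈⟨ +-identityʳ _ ⟨
      1# * b k i + 0#
        ≈⟨ +-cong (*-congʳ (reflexive (insertAt-lookup _ k 1#)))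
                  (sum-zero λ j → trans (*-congʳ (reflexive (insertAt-punchIn _ k 1# j))) (zeroˡ _)) ⟨
      insertAt (λ _ → 0#) k 1# k * b k i + sum (λ j → insertAt (λ _ → 0#) k 1# (punchIn k j) * b (punchIn k j) i)
        ≈⟨ sum-remove {i = k} (λ j → insertAt (λ _ → 0#) k 1# j * b j i) ⟨
      sum (λ j → insertAt (λ _ → 0#) k 1# j * b j i) ∎

    -- The coefficient vectors are `m + 1` vectors of length `m`, hence dependent; exchanging the
    -- two sums carries their relation over to the functions.
    combinations-dependent : ∀ {m} (b : Fin m → X → Carrier) (g : Fin (ℕ.suc m) → X → Carrier) →
      (∀ k → IsCombination b (g k)) →
      ¬ ¬ (∃[ c ] (NonTrivial c × ∀ z → sum (λ k → c k * g k z) ≈ 0#))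
    combinations-dependent {m} b g comb ¬dep =
      linearlyDependent m (λ k → proj₁ (comb k)) λ where
        (c , c≉0 , rel) → ¬dep (c , c≉0 , λ z → begin
          sum (λ k → c k * g k z)
            ≈⟨ sum-cong-≋ (λ k → *-congˡ {c k} (proj₂ (comb k) z)) ⟩
          sum (λ k → c k * sum (λ j → u k j * b j z))
            ≈⟨ sum-cong-≋ (λ k → *-distribˡ-sum (c k) (λ j → u k j * b j z)) ⟩
          sum (λ k → sum (λ j → c k * (u k j * b j z)))
            ≈⟨ ∑-comm (λ k j → c k * (u k j * b j z)) ⟩
          sum (λ j → sum (λ k → c k * (u k j * b j z)))
            ≈⟨ sum-cong-≋ (λ j → sum-cong-≋ λ k → *-assoc (c k) (u k j) (b j z)) ⟨
          sum (λ j → sum (λ k → c k * u k j * b j z))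
            ≈⟨ sum-cong-≋ (λ j → *-distribʳ-sum (b j z) (λ k → c k * u k j)) ⟨
          sum (λ j → sum (λ k → c k * u k j) * b j z)
            ≈⟨ sum-zero (λ j → trans (*-congʳ {b j z} (rel j)) (zeroˡ (b j z))) ⟩
          0# ∎)
      where
      u : Fin (ℕ.suc m) → Vector Carrier m
      u k = proj₁ (comb k)

  -- A nontrivial relation among the `g k`, evaluated at a point `i` with `c i` nonzero, would
  -- reduce to `c i * g i i`, which is nonzero in a domain.
  no-diagonal : ∀ {m} (b : Fin m → Fin (ℕ.suc m) → Carrier)
    (g : Fin (ℕ.suc m) → Fin (ℕ.suc m) → Carrier) →
    (∀ k → IsCombination b (g k)) →
    (∀ k → ¬ g k k ≈ 0#) → ¬ (∀ k l → k ≢ l → g k l ≈ 0#)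
  no-diagonal b g comb diag≉0 off≈0 = combinations-dependent b g comb λ where
    (c , (i , ci≉0) , rel) → *-≉0 ci≉0 (diag≉0 i) (begin
      c i * g i i
        ≈⟨ +-identityʳ _ ⟨
      c i * g i i + 0#
        ≈⟨ +-congˡ (sum-zero λ j → trans (*-congˡ (off≈0 (punchIn i j) i (Fin.punchInᵢ≢i i j)))
                                          (zeroʳ (c (punchIn i j)))) ⟨
      c i * g i i + sum (λ j → c (punchIn i j) * g (punchIn i j) i)
        ≈⟨ sum-remove {i = i} (λ k → c k * g k i) ⟨
      sum (λ k → c k * g k i)
        ≈⟨ rel i ⟩
      0# ∎)

  -- Products of linear factors

  rootProduct : List Carrier → Carrier → Carrier
  rootProduct as y = foldr (λ a p → (y - a) * p) 1# as

  rootProduct-root : ∀ {as y} → y ∈ˡ as → rootProduct as y ≈ 0#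
  rootProduct-root (here y≈a)   = trans (*-congʳ (x≈y⇒x∙y⁻¹≈ε y≈a)) (zeroˡ _)
  rootProduct-root (there y∈as) = trans (*-congˡ (rootProduct-root y∈as)) (zeroʳ _)

  rootProduct-nonroot : ∀ {as y} → All (λ a → ¬ y ≈ a) as → ¬ rootProduct as y ≈ 0#
  rootProduct-nonroot []              = 1≉0
  rootProduct-nonroot (y≉a ∷ y≉as) =
    *-≉0 (λ y-a≈0 → y≉a (x∙y⁻¹≈ε⇒x≈y _ _ y-a≈0)) (rootProduct-nonroot y≉as)

  -- The one-variable Newton recurrence, from `y = (y - a) + a`.
  peel-factor : ∀ y a p → y * p ≈ (y - a) * p + a * p
  peel-factor y a p = begin
    y * p                     ≈⟨ *-congʳ (begin
      y                         ≈⟨ +-identityʳ y ⟨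
      y + 0#                    ≈⟨ +-congˡ (-‿inverseˡ a) ⟨
      y + (- a + a)             ≈⟨ +-assoc y (- a) a ⟨
      y - a + a                 ∎) ⟩
    (y - a + a) * p           ≈⟨ distribʳ p (y - a) a ⟩
    (y - a) * p + a * p       ∎

  -- Newton's basis: the nodes along coordinate l are a l 0, a l 1, …, and the
  -- multi-index α selects the first α l of them.
  newton : ∀ {n} → (Fin n → ℕ → Carrier) → Vector ℕ n → Vector Carrier n → Carrier
  newton {ℕ.zero}  a α x = 1#
  newton {ℕ.suc n} a α x =
    rootProduct (applyDownFrom (a zero) (α zero)) (x zero) * newton (a ∘ suc) (α ∘ suc) (x ∘ suc)

  newton-cong : ∀ {n} (a : Fin n → ℕ → Carrier) {α β} → α ≗ β → ∀ x → newton a α x ≈ newton a β x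
  newton-cong {ℕ.zero}  a α≗β x = refl
  newton-cong {ℕ.suc n} a α≗β x =
    *-cong (reflexive (≡.cong (λ j → rootProduct (applyDownFrom (a zero) j) (x zero)) (α≗β zero)))
           (newton-cong (a ∘ suc) (α≗β ∘ suc) (x ∘ suc))

  newton-root : ∀ {n} (a : Fin n → ℕ → Carrier) α x l →
    x l ∈ˡ applyDownFrom (a l) (α l) → newton a α x ≈ 0#
  newton-root a α x zero    x∈ = trans (*-congʳ (rootProduct-root x∈)) (zeroˡ _)
  newton-root a α x (suc l) x∈ =
    trans (*-congˡ (newton-root (a ∘ suc) (α ∘ suc) (x ∘ suc) l x∈)) (zeroʳ _)

  newton-constant : ∀ {n} (a : Fin n → ℕ → Carrier) x → newton a (λ _ → 0) x ≈ 1#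
  newton-constant {ℕ.zero}  a x = refl
  newton-constant {ℕ.suc n} a x =
    trans (*-identityˡ _) (newton-constant (a ∘ suc) (x ∘ suc))

  -- `peel-factor` is applied in coordinate `l` with the next unselected node `a l (α l)`. Since
  -- `applyDownFrom` puts the newest node first, the enlarged product has the factor
  -- `x l - a l (α l)` at its head.
  newton-step : ∀ {n} (a : Fin n → ℕ → Carrier) α x l →
    x l * newton a α x ≈ newton a (updateAt α l ℕ.suc) x + a l (α l) * newton a α x
  newton-step a α x zero = begin
    y * (p * r)                       ≈⟨ peel-factor y b (p * r) ⟩
    (y - b) * (p * r) + b * (p * r)   ≈⟨ +-congʳ (*-assoc (y - b) p r) ⟨
    (y - b) * p * r + b * (p * r)     ∎
    where
    y = x zero
    b = a zero (α zero)
    p = rootProduct (applyDownFrom (a zero) (α zero)) (x zero)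
    r = newton (a ∘ suc) (α ∘ suc) (x ∘ suc)
  newton-step a α x (suc l) = begin
    y * (p * r)             ≈⟨ x∙yz≈y∙xz y p r ⟩
    p * (y * r)             ≈⟨ *-congˡ (newton-step (a ∘ suc) (α ∘ suc) (x ∘ suc) l) ⟩
    p * (r′ + b * r)        ≈⟨ distribˡ p r′ (b * r) ⟩
    p * r′ + p * (b * r)    ≈⟨ +-congˡ (x∙yz≈y∙xz p b r) ⟩
    p * r′ + b * (p * r)    ∎
    where
    y = x (suc l)
    b = a (suc l) (α (suc l))
    p = rootProduct (applyDownFrom (a zero) (α zero)) (x zero)
    r = newton (a ∘ suc) (α ∘ suc) (x ∘ suc)
    r′ = newton (a ∘ suc) (updateAt (α ∘ suc) l ℕ.suc) (x ∘ suc)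

  -- Functions spanned by Newton products of bounded degree.

  module NewtonSpan {n z} {X : Set z} (a : Fin n → ℕ → Carrier) (x : X → Vector Carrier n) where

    infixl 6 _+ˢ_
    infixr 7 _*ˢ_

    -- Only the total degree is tracked; single exponents may reach or exceed the side length of the
    -- box, and `newton-combination` deals with those later. The inductive form lets closure
    -- properties be proved by recursion on how a function was built.
    data Span (d : ℕ) : (X → Carrier) → Set (c ⊔ ℓ ⊔ z) where
      basis : ∀ α → degree α ≤ d → Span d (λ i → newton a α (x i))
      0ˢ    : Span d (λ _ → 0#)
      _+ˢ_  : ∀ {g h} → Span d g → Span d h → Span d (λ i → g i + h i)
      _*ˢ_  : ∀ {g} r → Span d g → Span d (λ i → r * g i)
      resp  : ∀ {g h} → (∀ i → g i ≈ h i) → Span d g → Span d h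

    weakenˢ : ∀ {d e g} → d ≤ e → Span d g → Span e g
    weakenˢ d≤e (basis α α≤d) = basis α (ℕ.≤-trans α≤d d≤e)
    weakenˢ d≤e 0ˢ            = 0ˢ
    weakenˢ d≤e (g +ˢ h)      = weakenˢ d≤e g +ˢ weakenˢ d≤e h
    weakenˢ d≤e (r *ˢ g)      = r *ˢ weakenˢ d≤e g
    weakenˢ d≤e (resp g≈h g)  = resp g≈h (weakenˢ d≤e g)

    -- On a basis function, `newton-step` gives one term whose degree grows by one and one of
    -- unchanged degree; multiplication by a coordinate commutes with the other constructors.
    coordinate-* : ∀ {d g} l → Span d g → Span (ℕ.suc d) (λ i → x i l * g i)
    coordinate-* l (basis α α≤d) =
      resp (λ i → sym (newton-step a α (x i) l))
        (basis (updateAt α l ℕ.suc) (ℕ.≤-trans (ℕ.≤-reflexive (degree-updateAt-suc α l)) (ℕ.s≤s α≤d))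
         +ˢ (a l (α l) *ˢ basis α (ℕ.m≤n⇒m≤1+n α≤d)))
      where
      degree-updateAt-suc : ∀ {n} (α : Vector ℕ n) l → degree (updateAt α l ℕ.suc) ≡ ℕ.suc (degree α)
      degree-updateAt-suc α zero    = ≡.refl
      degree-updateAt-suc α (suc l) = ≡.trans
        (≡.cong (α zero ℕ.+_) (degree-updateAt-suc (α ∘ suc) l)) (ℕ.+-suc (α zero) _)
    coordinate-* l 0ˢ            = resp (λ i → sym (zeroʳ (x i l))) 0ˢ
    coordinate-* l (g +ˢ h)      =
      resp (λ i → sym (distribˡ (x i l) _ _)) (coordinate-* l g +ˢ coordinate-* l h)
    coordinate-* l (r *ˢ g)      = resp (λ i → x∙yz≈y∙xz r (x i l) _) (r *ˢ coordinate-* l g)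
    coordinate-* l (resp g≈h g)  = resp (λ i → *-congˡ (g≈h i)) (coordinate-* l g)

    sumˢ : ∀ {d m} {h : Fin m → X → Carrier} → (∀ l → Span d (h l)) → Span d (λ i → sum (λ l → h l i))
    sumˢ {m = ℕ.zero}  h = 0ˢ
    sumˢ {m = ℕ.suc m} {h} spans = spans zero +ˢ sumˢ {h = h ∘ suc} (spans ∘ suc)

    linear : Vector Carrier n → X → Carrier
    linear w i = sum (λ l → w l * x i l)

    linear-* : ∀ {d g} w → Span d g → Span (ℕ.suc d) (λ i → linear w i * g i)
    linear-* {g = g} w sp = resp
      (λ i → trans (sum-cong-≋ λ l → sym (*-assoc (w l) (x i l) (g i)))
                   (sym (*-distribʳ-sum (g i) (λ l → w l * x i l))))
      (sumˢ {h = λ l i → w l * (x i l * g i)} λ l → w l *ˢ coordinate-* l sp)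

    -- In each factor `linear w i - d` the linear part raises the degree by one and the constant
    -- part leaves it alone.
    span-rootProduct : ∀ w ds → Span (length ds) (λ i → rootProduct ds (linear w i))
    span-rootProduct w []       =
      resp (λ i → newton-constant a (x i)) (basis (λ _ → 0) (ℕ.≤-reflexive (degree-constant n)))
      where
      degree-constant : ∀ n → degree {n} (λ _ → 0) ≡ 0
      degree-constant ℕ.zero    = ≡.refl
      degree-constant (ℕ.suc n) = degree-constant n
    span-rootProduct w (d ∷ ds) =
      resp (λ i → sym (distribʳ (rootProduct ds (linear w i)) (linear w i) (- d)))
        (linear-* w (span-rootProduct w ds)
         +ˢ weakenˢ (ℕ.n≤1+n (length ds)) ((- d) *ˢ span-rootProduct w ds))

    span⇒combination : ∀ {m d g} (b : Fin m → X → Carrier) →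
      (∀ α → degree α ≤ d → IsCombination b (λ i → newton a α (x i))) →
      Span d g → IsCombination b g
    span⇒combination {d = d} b basis-comb = go
      where
      go : ∀ {g} → Span d g → IsCombination b g
      go (basis α α≤d) = basis-comb α α≤d
      go 0ˢ = combination-zero b λ _ → refl
      go (g +ˢ h) with go g | go h
      ... | u , g≈ | v , h≈ = (λ j → u j + v j) , λ i →
        trans (+-cong (g≈ i) (h≈ i))
          (trans (sym (∑-distrib-+ (λ j → u j * b j i) (λ j → v j * b j i)))
                 (sum-cong-≋ λ j → sym (distribʳ (b j i) (u j) (v j))))
      go (r *ˢ g) with go g
      ... | u , g≈ = (λ j → r * u j) , λ i →
        trans (*-congˡ (g≈ i))
          (trans (*-distribˡ-sum r (λ j → u j * b j i))
                 (sum-cong-≋ λ j → sym (*-assoc r (u j) (b j i))))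
      go (resp g≈h g) with go g
      ... | u , g≈ = u , λ i → trans (sym (g≈h i)) (g≈ i)

  -- Counting the points of a box

  module _ {n q s m} (node : Fin n → ℕ → Carrier) (p : Fin (ℕ.suc m) → Vector Carrier n)
    (exponent : Fin m → Vector ℕ n)
    (on-node : ∀ k l → ∃[ t ] (t ℕ.< q × p k l ≈ node l t))
    (index : ∀ α → (∀ l → α l ℕ.< q) → degree α ≤ s → ∃[ j ] (exponent j ≗ α))
    where

    open NewtonSpan node p

    private
      monomial : Fin m → Fin (ℕ.suc m) → Carrier
      monomial j k = newton node (exponent j) (p k)

    -- Every `l`-th coordinate is among the first `q` nodes of its line, and all of these are
    -- selected once `α l` is at least `q`.
    newton-vanishes : ∀ α l → q ≤ α l → ∀ k → newton node α (p k) ≈ 0#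
    newton-vanishes α l q≤αl k with on-node k l
    ... | t , t<q , pkl≈ = newton-root node α (p k) l
      (∈ₛ.∈-resp-≈ setoid (sym pkl≈) (∈ₛ.∈-applyDownFrom⁺ setoid (node l) (ℕ.<-≤-trans t<q q≤αl)))

    -- This replaces the reduction of polynomials modulo the ideal of the box: a multi-index either
    -- is one of the `m` enumerated ones or gives the zero function on the points.
    newton-combination : ∀ α → degree α ≤ s → IsCombination monomial (λ k → newton node α (p k))
    newton-combination α ∣α∣≤s with Fin.all? (λ l → α l ℕ.<? q)
    ... | yes α<q with index α α<q ∣α∣≤s
    ...   | j , ≗α = combination-single monomial j λ k → newton-cong node (≡.sym ∘ ≗α) (p k)
    newton-combination α ∣α∣≤s | no ¬α<q with Fin.¬∀⟶∃¬ n _ (λ l → α l ℕ.<? q) ¬α<q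
    ... | l , αl≮q = combination-zero monomial (newton-vanishes α l (ℕ.≮⇒≥ αl≮q))

    -- The `m + 1` functions `rootProduct ds (linear (p k) l)` of `l` would form a diagonal family
    -- with nonzero diagonal inside the span of `m` functions.
    point-bound : ∀ ds → length ds ≤ s →
      (∀ k → All (λ d → ¬ linear (p k) k ≈ d) ds) →
      ¬ (∀ k l → k ≢ l → ¬ ¬ (linear (p k) l ∈ˡ ds))
    point-bound ds ∣ds∣≤s diag∉ off∈ =
      no-diagonal monomial (λ k l → rootProduct ds (linear (p k) l))
        (λ k → span⇒combination monomial newton-combination
                 (weakenˢ ∣ds∣≤s (span-rootProduct (p k) ds)))
        (λ k → rootProduct-nonroot (diag∉ k))
        -- Membership in `ds` is known only up to double negation, which suffices since vanishing is
        -- stable.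
        (λ k l k≢l → ≈0-stable (¬¬-map rootProduct-root (off∈ k l k≢l)))

-- Lists exhausting a setoid of bounded size.

module _ {c ℓ} (T : Setoid c ℓ) where
  open Setoid T
  open Membership T renaming (_∈_ to _∈ˡ_)

  lookup-injective : ∀ {xs} → Unique T xs → ∀ {i j} → lookup xs i ≈ lookup xs j → i ≡ j
  lookup-injective (x∉xs ∷ xs!) {zero}  {zero}  _  = ≡.refl
  lookup-injective (x∉xs ∷ xs!) {zero}  {suc j} eq = contradiction eq (All.lookup x∉xs (∈.∈-lookup j))
  lookup-injective (x∉xs ∷ xs!) {suc i} {zero}  eq =
    contradiction (sym eq) (All.lookup x∉xs (∈.∈-lookup i))
  lookup-injective (x∉xs ∷ xs!) {suc i} {suc j} eq = ≡.cong suc (lookup-injective xs! eq)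

  module _ {s} (bounded : ∀ k → Injection (≡.setoid (Fin k)) T → k ≤ s) where

    unique-length : ∀ xs → Unique T xs → length xs ≤ s
    unique-length xs xs! = bounded (length xs) record
      { to        = lookup xs
      ; cong      = λ { ≡.refl → refl }
      ; injective = lookup-injective xs!
      }

    -- If no list were exhaustive, a duplicate-free list could always be extended by an element
    -- outside it, until its length exceeded `s`.
    exhaustive-list : ¬ ¬ (∃[ xs ] (length xs ≤ s × ∀ x → ¬ ¬ (x ∈ˡ xs)))
    -- The fuel `s + 1` gives the invariant `s < u + length xs`, so that running out of fuel means a
    -- duplicate-free list longer than `s`.
    exhaustive-list = extend (ℕ.suc s) [] [] (ℕ.≤-reflexive (≡.sym (ℕ.+-identityʳ (ℕ.suc s))))
      where
      extend : ∀ u xs → Unique T xs → s ℕ.< u ℕ.+ length xs →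
               ¬ ¬ (∃[ xs ] (length xs ≤ s × ∀ x → ¬ ¬ (x ∈ˡ xs)))
      extend ℕ.zero    xs xs! s<∣xs∣   _    = ℕ.<⇒≱ s<∣xs∣ (unique-length xs xs!)
      extend (ℕ.suc u) xs xs! s<u+∣xs∣ none = none (xs , unique-length xs xs! , λ x x∉xs →
        extend u (x ∷ xs) (All.¬Any⇒All¬ xs x∉xs ∷ xs!)
          (ℕ.≤-trans s<u+∣xs∣ (ℕ.≤-reflexive (≡.sym (ℕ.+-suc u (length xs))))) none)

-- Enumeration of the monomials.

module _ {n q s : ℕ} (1≤q : 1 ≤ q) where

  private
    -- The base-`q` digits of a code, so that admissible monomials arise by filtering a finite list
    -- with a decidable degree test.
    exponents : Fin (q ^ n) → Vector ℕ n
    exponents e = toℕ ∘ finToFun e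

    exponents-injective : ∀ e e′ → exponents e ≗ exponents e′ → e ≡ e′
    exponents-injective e e′ eq = ≡.trans (≡.sym (Fin.funToFin-finToFin {n} e))
      (≡.trans (funToFin-cong λ i → Fin.toℕ-injective (eq i)) (Fin.funToFin-finToFin {n} e′))
      where
      funToFin-cong : ∀ {m n} {f g : Fin m → Fin n} → f ≗ g → funToFin f ≡ funToFin g
      funToFin-cong {ℕ.zero}  f≗g = ≡.refl
      funToFin-cong {ℕ.suc m} f≗g = ≡.cong₂ combine (f≗g zero) (funToFin-cong (f≗g ∘ suc))

    codes : List (Fin (q ^ n))
    codes = filter (λ e → degree (exponents e) ℕ.≤? s) (allFin (q ^ n))

  monomials-finite : ∃[ m ] (monomials n q s HasCardinality m)
  monomials-finite = length codes , record
    { to        = λ j → exponents (lookup codes j)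
                , (λ i → Fin.toℕ≤pred[n] (finToFun (lookup codes j) i))
                , All.lookup (All.all-filter _ (allFin (q ^ n))) (∈.∈-lookup j)
    ; cong      = λ { ≡.refl i → ≡.refl }
    ; bijective = (λ {i} {j} eq → lookup-injective (≡.setoid _)
                     (Unique.filter⁺ _ (Unique.allFin⁺ (q ^ n)))
                     (exponents-injective (lookup codes i) (lookup codes j) eq))
                , surjective
    }
    where
    surjective : ∀ (α : Setoid.Carrier (elements (monomials n q s))) → ∃[ j ]
      (∀ {k} → k ≡ j → exponents (lookup codes k) ≗ proj₁ α)
    surjective (α , α≤q-1 , ∣α∣≤s) = Any.index code∈ , λ { ≡.refl i →
        ≡.trans (≡.cong (λ e → exponents e i) (≡.sym (Any.lookup-index code∈))) (exponents-code i) }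
      where
      digit : Fin n → Fin q
      -- Positivity of `q` makes `q ∸ 1` smaller than `q` despite truncated subtraction.
      digit i = fromℕ< (ℕ.≤-<-trans (α≤q-1 i) (ℕ.∸-monoʳ-< {q} ℕ.z<s 1≤q))

      exponents-code : exponents (funToFin digit) ≗ α
      exponents-code i = ≡.trans (≡.cong toℕ (Fin.finToFun-funToFin digit i)) (Fin.toℕ-fromℕ< _)

      code∈ : Any (funToFin digit ≡_) codes
      code∈ = ∈.∈-filter⁺ _ (∈.∈-allFin (funToFin digit))
        (≡.subst (_≤ s) (≡.sym (degree-cong exponents-code)) ∣α∣≤s)

-- The bound for a set of points in a real box.

padded : ∀ {a} {A : Set a} {n} → A → Vector A n → ℕ → A
padded {n = ℕ.zero}  d v j         = d
padded {n = ℕ.suc n} d v ℕ.zero    = v zero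
padded {n = ℕ.suc n} d v (ℕ.suc j) = padded d (v ∘ suc) j

padded-toℕ : ∀ {a} {A : Set a} {n} d (v : Vector A n) i → padded d v (toℕ i) ≡ v i
padded-toℕ d v zero    = ≡.refl
padded-toℕ d v (suc i) = padded-toℕ d (v ∘ suc) i

open IntegralDomain ℝ-commutativeRing ℝ-isIntegralDomain using (point-bound)

module _ {a f} {n q s m : ℕ}
  (A : Fin n → Subset ℝ-setoid a) (card : ∀ l → A l HasCardinality q)
  (F : Subset (ℝ^ n) f) (F⊆box : F ⊆ box A)
  (norm∉ : ∀ x → x ∈ F → ¬ (⟨ x , x ⟩ ∈ scalarProducts F))
  (bounded : scalarProducts F HasCardinality≤ s)
  (enumeration : monomials n q s HasCardinality m)
  where

  private
    node : Fin n → ℕ → ℝ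
    -- Nodes are indexed by all naturals because exponents in `Span` can pass `q`. The filler `0ℝ`
    -- from position `q` on is harmless: a product that selects it already contains all `q` elements
    -- of `A l` as nodes.
    node l = padded 0ℝ (proj₁ ∘ Bijection.to (card l))

    on-node : ∀ x → x ∈ F → ∀ l → ∃[ t ] (t ℕ.< q × x l ≈ℝ node l t)
    on-node x x∈F l with Bijection.surjective (card l) (x l , F⊆box x x∈F l)
    ... | t , ≈xl = toℕ t , Fin.toℕ<n t ,
      ≡.subst (x l ≈ℝ_) (≡.sym (padded-toℕ 0ℝ _ t)) (≈ℝ-sym (≈xl ≡.refl))

    index : ∀ α → (∀ l → α l ℕ.< q) → degree α ≤ s →
            ∃[ j ] (proj₁ (Bijection.to enumeration j) ≗ α)
    index α α<q ∣α∣≤s with Bijection.surjective enumeration (α , (λ l → ℕ.<⇒≤pred (α<q l)) , ∣α∣≤s)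
    ... | j , ≗α = j , ≗α ≡.refl

  module _ (p : Fin (ℕ.suc m) → Vector ℝ n) (p∈F : ∀ k → p k ∈ F)
    (distinct : ∀ k l → k ≢ l → ¬ p k ≋ℝ p l)
    where

    private
      Products : Setoid _ _
      Products = elements (scalarProducts F)

      open Membership Products renaming (_∈_ to _∈ₚ_)

      scalarProduct : ∀ k l → k ≢ l → Setoid.Carrier Products
      scalarProduct k l k≢l =
        ⟨ p k , p l ⟩ , p k , p l , p∈F k , p∈F l , distinct k l k≢l , ≈ℝ-refl

      norm≉ : ∀ k (d : Setoid.Carrier Products) → ¬ ⟨ p k , p k ⟩ ≈ℝ proj₁ d
      norm≉ k (d , d∈) norm≈d =
        norm∉ (p k) (p∈F k) (Subset.respects (scalarProducts F) (≈ℝ-sym norm≈d) d∈)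

      module _ (ds : List (Setoid.Carrier Products)) where
        values : List ℝ
        values = map proj₁ ds

        norms∉ : ∀ k → All (λ d → ¬ ⟨ p k , p k ⟩ ≈ℝ d) values
        norms∉ k = All.map⁺ (All.universal (norm≉ k) ds)

        -- Equality in `Products` compares only the values, so membership passes to the list of
        -- reals.
        products∈ : (∀ r → ¬ ¬ (r ∈ₚ ds)) →
          ∀ k l → k ≢ l → ¬ ¬ (Membership._∈_ ℝ-setoid ⟨ p k , p l ⟩ values)
        products∈ covers k l k≢l = ¬¬-map Any.map⁺ (covers (scalarProduct k l k≢l))

    -- The goal is `⊥`, so the list that `exhaustive-list` yields up to double negation can be used.
    -- The sums `linear (p k) l` of `point-bound` unfold to the scalar products `⟨ p k , p l ⟩`.
    not-distinct : ⊥
    not-distinct = exhaustive-list Products bounded λ (ds , ∣ds∣≤s , covers) →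
      point-bound {q = q} {s = s} node p (λ j → proj₁ (Bijection.to enumeration j))
        (λ k → on-node (p k) (p∈F k)) index (values ds)
        (ℕ.≤-trans (ℕ.≤-reflexive (length-map proj₁ ds)) ∣ds∣≤s) (norms∉ ds) (products∈ ds covers)

  cardinality-bound : F HasCardinality≤ m
  cardinality-bound k points = ℕ.≮⇒≥ λ m<k →
    let open Injection points
        -- A family longer than `m` is cut down to its first `m + 1` terms.
        p = to ∘ λ i → inject≤ i m<k
    in not-distinct (proj₁ ∘ p) (proj₂ ∘ p)
         λ i j i≢j pi≈pj → i≢j (Fin.inject≤-injective m<k m<k i j (injective pi≈pj))

theorem1p7 : ∀ {a f : Level} (n q s : ℕ) → 1 ≤ n → 2 ≤ q →
    (A : Fin n → Subset ℝ-setoid a) → (∀ i → A i HasCardinality q) →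
    (F : Subset (ℝ^ n) f) → F ⊆ box A →
    (∀ (x : Vector ℝ n) → x ∈ F → ¬ (⟨ x , x ⟩ ∈ scalarProducts F)) →
    scalarProducts F HasCardinality≤ s →
    ∃[ m ] (monomials n q s HasCardinality m × F HasCardinality≤ m)
theorem1p7 n q s _ 2≤q A card F F⊆box norm∉ bounded =
  m , enumeration , cardinality-bound A card F F⊆box norm∉ bounded enumeration
  where
  finite : ∃[ m ] (monomials n q s HasCardinality m)
  finite = monomials-finite (ℕ.<⇒≤ 2≤q)
  m : ℕ
  m = proj₁ finite
  enumeration : monomials n q s HasCardinality m
  enumeration = proj₂ finite
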